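{- Let $T$ be a nonspecial $\omega_1$-tree. Then $\diamondsuit_T$ implies $\diamondsuit$.
   Context: A tree is a partial order $(T,<_T)$ in which the set of predecessors of each node is well-ordered; every tree is assumed to have a root, denoted $\emptyset$. For $t\in T$, $t{\downarrow}=\{s\in T\mid s<_T t\}$, $\mathrm{ht}(t)$ is the order type of $t{\downarrow}$, and $T_\alpha$ is the set of nodes of height $\alpha$. The height of $T$ is the least $\alpha$ with $T_\alpha=\emptyset$. An $\omega_1$-tree is a tree of height $\omega_1$ all of whose levels $T_\alpha$ are countable. An antichain is a set of pairwise incomparable nodes. A set $U\subseteq T$ is special if it is a union of at most countably many antichains; otherwise it is nonspecial. For $X\subseteq T$, a map $f:X\to T$ is regressive if $f(t)<_T t$ for all $t\in X\setminus\{\emptyset\}$. For $T$ of height $\omega_1$, $NS^T$ is the ideal of all $B\subseteq T$ for which there is a regressive $f:B\to T$ such that $f^{ -1}(\{t\})$ is special for every $t\in T$. For a nonspecial tree $T$ of height $\omega_1$, $\diamondsuit_T$ asserts that there is a sequence $(D_t\mid t\in T)$ with $D_t\subseteq t{\downarrow}$ for all $t\in T$ such that for every $X\subseteq T$, $\{t\in T\mid X\cap t{\downarrow}=D_t\}\notin NS^T$. $\diamondsuit$ is Jensen's principle: there is $(D_\alpha)_{\alpha<\omega_1}$ with $D_\alpha\subseteq\alpha$ such that for every $X\subseteq\omega_1$ the set $\{\alpha<\omega_1\mid X\cap\alpha=D_\alpha\}$ is stationary. -}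

module Defs where

open import Data.Nat.Base using (ℕ)
open import Data.Product.Base using (∃; ∃-syntax; Σ-syntax; _×_; proj₁)
open import Data.Sum.Base using (_⊎_)
open import Function.Base using (_on_)
open import Induction.WellFounded using (WellFounded)
open import Level using (Level; _⊔_; suc)
open import Relation.Binary.Core using (Rel)
open import Relation.Binary.Morphism.Structures using (IsOrderIsomorphism)
open import Relation.Binary.Structures using (IsStrictPartialOrder; IsStrictTotalOrder)
open import Relation.Binary.PropositionalEquality.Core using (_≡_; _≢_)
open import Relation.Nullary.Negation.Core using (¬_)
open import Relation.Unary using (Pred; _∈_; _⊆_; _≐_; _∩_; U; ⋃)

private
  variable
    a b p q r s ℓ : Level

-- Sets are types with propositional equality, and subsets are predicates,
-- two subsets being equal when they include each other (_≐_).  An element of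
-- the subtype ∃ P carries a proof of membership, so elements of subtypes are
-- compared through proj₁ only.

Countable : {A : Set a} → Pred A p → Set (a ⊔ p)
Countable {A = A} P =
  Σ[ f ∈ (A → ℕ) ] (∀ {x y} → x ∈ P → y ∈ P → f x ≡ f y → x ≡ y)

record WellOrdered {A : Set a} (_<_ : Rel A r) (P : Pred A p) : Set (a ⊔ r ⊔ p) where
  field
    isStrictTotalOrder : IsStrictTotalOrder {A = ∃ P} (_≡_ on proj₁) (_<_ on proj₁)
    wellFounded        : WellFounded {A = ∃ P} (_<_ on proj₁)

SameOrderType : {A : Set a} {B : Set b} →
                Rel A r → Pred A p → Rel B s → Pred B q →
                Set (a ⊔ b ⊔ r ⊔ s ⊔ p ⊔ q)
SameOrderType _<₁_ P _<₂_ Q =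
  Σ[ f ∈ (∃ P → ∃ Q) ]
    IsOrderIsomorphism (_≡_ on proj₁) (_≡_ on proj₁) (_<₁_ on proj₁) (_<₂_ on proj₁) f

-- The ordinal ω₁, pinned down up to (unique) isomorphism: an uncountable
-- well-order all of whose proper initial segments are countable.  The
-- ordinal α < ω₁ is an element of the carrier, and as a set of ordinals it
-- is the initial segment below α.

record Omega₁ ℓ : Set (suc ℓ) where
  infix 4 _<_
  field
    Carrier     : Set ℓ
    _<_         : Rel Carrier ℓ
    wellOrdered : WellOrdered _<_ (U {A = Carrier})

  below : Carrier → Pred Carrier ℓ
  below α β = β < α

  field
    below-countable : ∀ α → Countable (below α)
    uncountable     : ¬ Countable (U {A = Carrier})

module _ (Ω : Omega₁ ℓ) where
  open Omega₁ Ω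

  IsLimit : Pred Carrier ℓ
  IsLimit δ = (∃[ β ] β < δ) × (∀ β → β < δ → ∃[ γ ] (β < γ × γ < δ))

  record Club (C : Pred Carrier ℓ) : Set ℓ where
    field
      unbounded : ∀ β → ∃[ γ ] (γ ∈ C × β < γ)
      closed    : ∀ δ → IsLimit δ →
                  (∀ β → β < δ → ∃[ γ ] (γ ∈ C × β < γ × γ < δ)) → δ ∈ C

  Stationary : Pred Carrier ℓ → Set (suc ℓ)
  Stationary S = ∀ (C : Pred Carrier ℓ) → Club C → ∃ (S ∩ C)

  ◇ : Set (suc ℓ)
  ◇ = Σ[ D ∈ (Carrier → Pred Carrier ℓ) ]
        (∀ α → D α ⊆ below α) ×
        (∀ (X : Pred Carrier ℓ) → Stationary (λ α → (X ∩ below α) ≐ D α))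

record Tree ℓ : Set (suc ℓ) where
  infix 4 _<_
  field
    Carrier              : Set ℓ
    _<_                  : Rel Carrier ℓ
    isStrictPartialOrder : IsStrictPartialOrder _≡_ _<_

  infix 8 _↓
  _↓ : Carrier → Pred Carrier ℓ
  (t ↓) s = s < t

  field
    ↓-wellOrdered : ∀ t → WellOrdered _<_ (t ↓)
    root          : Carrier
    root-least    : ∀ t → t ≡ root ⊎ root < t

module _ (T : Tree ℓ) (Ω : Omega₁ ℓ) where
  open Tree T
  private module Ω = Omega₁ Ω

  Level[_] : Ω.Carrier → Pred Carrier ℓ
  Level[ α ] t = SameOrderType _<_ (t ↓) Ω._<_ (Ω.below α)

  Levelω₁ : Pred Carrier ℓ
  Levelω₁ t = SameOrderType _<_ (t ↓) Ω._<_ U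

  -- ω₁ is the least ordinal whose level is empty, and levels are countable.
  record IsOmega₁Tree : Set ℓ where
    field
      level-nonempty  : ∀ α → ∃ Level[ α ]
      levelω₁-empty   : ¬ ∃ Levelω₁
      level-countable : ∀ α → Countable Level[ α ]

module _ (T : Tree ℓ) where
  open Tree T

  Antichain : Pred Carrier ℓ → Set ℓ
  Antichain A = ∀ {s t} → s ∈ A → t ∈ A → ¬ (s < t)

  -- Antichains may be empty, so ℕ-indexed unions cover finite ones too.
  Special : ∀ {p} → Pred Carrier p → Set (suc ℓ ⊔ p)
  Special V = Σ[ A ∈ (ℕ → Pred Carrier ℓ) ] (∀ n → Antichain (A n)) × V ≐ ⋃ ℕ A

  NonspecialTree : Set (suc ℓ)
  NonspecialTree = ¬ Special U

  -- A map X → T is given by a map on all of T whose values outside X are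
  -- never inspected.
  Regressive : Pred Carrier ℓ → (Carrier → Carrier) → Set ℓ
  Regressive X f = ∀ t → t ∈ X → t ≢ root → f t < t

  NS : Pred Carrier ℓ → Set (suc ℓ)
  NS B = Σ[ f ∈ (Carrier → Carrier) ]
           Regressive B f × (∀ t → Special (B ∩ (λ s → f s ≡ t)))

  ◇ₜ : Set (suc ℓ)
  ◇ₜ = Σ[ D ∈ (Carrier → Pred Carrier ℓ) ]
         (∀ t → D t ⊆ t ↓) ×
         (∀ (X : Pred Carrier ℓ) → ¬ NS (λ t → (X ∩ t ↓) ≐ D t))

{-# OPTIONS --safe #-}
-- Let ht be the height function of T, fix an injection c : ω₁ × ω → ω₁, and
-- code a sequence (Xₙ) of subsets of ω₁ by the set X of the nodes whose height
-- lies in { c (β , n) | β ∈ Xₙ }.  Let D t guess X at a node t which is the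
-- n-th node of its level α, let α be closed under c, and read D t as a
-- sequence of subsets of α: its n-th entry is Xₙ ∩ α.  If for each n the
-- sequence formed by the n-th entry at the n-th node of every level failed to
-- guess some Xₙ on a club Cₙ, then D would guess the set coding (Xₙ) only at
-- nodes whose height avoids the intersection E of the Cₙ with the club of
-- closure points of c.  The set of such nodes is in NS^T: move a node t down
-- to a height β such that E has no point strictly between β and ht t; the
-- fibre over s then has heights at most min (E ∖ (ht s + 1)), so it lies in
-- countably many levels, and levels are antichains.
module Submission where

open import Defs
open import Axiom.ExcludedMiddle using (ExcludedMiddle)
open import Data.Nat.Base as ℕ using (ℕ; zero; _*_)
open import Data.Nat.Induction using () renaming (<-wellFounded to ℕ-<-wellFounded)
open import Data.Nat.Properties as ℕ using ()
open import Data.Product.Base using (∃; ∃-syntax; Σ-syntax; _×_; _,_; proj₁; proj₂)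
open import Data.Product.Relation.Binary.Lex.Strict using (×-Lex; ×-wellFounded)
open import Data.Sum.Base using (inj₁; inj₂)
open import Function.Base using (_on_; _∘_)
open import Induction.WellFounded using (Acc; acc; WellFounded)
open import Level using (Level; suc; Lift; lift; lower)
open import Relation.Binary.Core using (Rel)
open import Relation.Binary.Definitions using (Trichotomous; tri<; tri≈; tri>)
open import Relation.Binary.PropositionalEquality
  using (_≡_; _≢_; refl; sym; trans; cong; subst)
open import Relation.Binary.Structures using (IsStrictPartialOrder; IsStrictTotalOrder)
open import Relation.Nullary.Decidable.Core using (Dec; yes; no; map′; decidable-stable)
open import Relation.Nullary.Negation.Core using (¬_; contradiction)
open import Relation.Unary using (Pred; _∈_; _∉_; _≐_; _∩_; U)

-- This is 2^m (2n + 1), so injectivity follows by parity.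
pair : ℕ → ℕ → ℕ
pair zero      n = ℕ.suc (2 * n)
pair (ℕ.suc m) n = 2 * pair m n

pair-injective : ∀ m n m′ n′ → pair m n ≡ pair m′ n′ → m ≡ m′ × n ≡ n′
pair-injective zero      n zero       n′ eq =
  refl , ℕ.*-cancelˡ-≡ n n′ 2 (ℕ.suc-injective eq)
pair-injective zero      n (ℕ.suc m′) n′ eq =
  contradiction (sym eq) (ℕ.even≢odd (pair m′ n′) n)
pair-injective (ℕ.suc m) n zero       n′ eq =
  contradiction eq (ℕ.even≢odd (pair m n) n′)
pair-injective (ℕ.suc m) n (ℕ.suc m′) n′ eq
  with pair-injective m n m′ n′ (ℕ.*-cancelˡ-≡ (pair m n) (pair m′ n′) 2 eq)
... | refl , refl = refl , refl

-- Excluded middle for all types, and not only for propositions, yields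
-- witnesses, and so serves as a choice principle in all of what follows.
module _ {ℓ} (em : ExcludedMiddle (suc ℓ)) where

  em₀ : ExcludedMiddle ℓ
  em₀ = map′ lower lift (em {Lift (suc ℓ) _})

  byContradiction : {P : Set ℓ} → ¬ ¬ P → P
  byContradiction = decidable-stable em₀

  -- Countability, suprema and clubs in ω₁.

  module Ordinals (Ω : Omega₁ ℓ) where
    open Omega₁ Ω public
    open WellOrdered wellOrdered using (isStrictTotalOrder; wellFounded)
    private module STO = IsStrictTotalOrder isStrictTotalOrder

    compare : Trichotomous _≡_ _<_
    compare α β = STO.compare (α , _) (β , _)

    <-trans : ∀ {α β γ} → α < β → β < γ → α < γ
    <-trans {α} {β} {γ} = STO.trans {α , _} {β , _} {γ , _}

    <-irrefl : ∀ {α} → ¬ (α < α)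
    <-irrefl {α} = STO.irrefl {α , _} {α , _} refl

    <⇒≢ : ∀ {α β} → α < β → α ≢ β
    <⇒≢ α<β refl = <-irrefl α<β

    <-wellFounded : WellFounded _<_
    <-wellFounded α = go (wellFounded (α , _))
      where
      go : ∀ {x} → Acc (_<_ on proj₁) x → Acc _<_ (proj₁ x)
      go (acc rs) = acc λ β<α → go (rs {_ , _} β<α)

    least : (P : Pred Carrier ℓ) → ∃ P → ∃[ α ] (P α × (∀ β → β < α → ¬ P β))
    least P (α , Pα) = go α (<-wellFounded α) Pα
      where
      go : ∀ α → Acc _<_ α → P α → ∃[ α ] (P α × (∀ β → β < α → ¬ P β))
      go α (acc rs) Pα with em₀ {∃[ β ] (β < α × P β)}
      ... | yes (β , β<α , Pβ) = go β (rs β<α) Pβ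
      ... | no ∄β = α , Pα , λ β β<α Pβ → ∄β (β , β<α , Pβ)

    upTo-countable : ∀ α → Countable (λ β → ¬ (α < β))
    upTo-countable α = code , injective
      where
      code : Carrier → ℕ
      code β with compare β α
      -- Code zero is reserved for `α` itself, hence the shift; the value above `α` is junk.
      ... | tri< _ _ _ = ℕ.suc (proj₁ (below-countable α) β)
      ... | tri≈ _ _ _ = zero
      ... | tri> _ _ _ = zero

      injective : ∀ {β γ} → ¬ (α < β) → ¬ (α < γ) → code β ≡ code γ → β ≡ γ
      injective {β} {γ} α≮β α≮γ eq with compare β α | compare γ α
      ... | tri> _ _ α<β  | _              = contradiction α<β α≮β
      ... | tri< _ _ _    | tri> _ _ α<γ   = contradiction α<γ α≮γ
      ... | tri≈ _ _ _    | tri> _ _ α<γ   = contradiction α<γ α≮γ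
      ... | tri≈ _ refl _ | tri≈ _ refl _  = refl
      ... | tri< β<α _ _  | tri< γ<α _ _   =
        proj₂ (below-countable α) β<α γ<α (ℕ.suc-injective eq)

    upTo×ℕ-countable : ∀ α → Countable {A = Carrier × ℕ} (λ (β , _) → ¬ (α < β))
    upTo×ℕ-countable α =
      (λ (β , n) → pair n (code β)) ,
      λ {(β , m)} {(γ , n)} α≮β α≮γ eq → inj α≮β α≮γ (pair-injective m (code β) n (code γ) eq)
      where
      code : Carrier → ℕ
      code = proj₁ (upTo-countable α)

      inj : ∀ {β γ m n} → ¬ (α < β) → ¬ (α < γ) →
            m ≡ n × code β ≡ code γ → (β , m) ≡ (γ , n)
      inj α≮β α≮γ (refl , eq) = cong (_, _) (proj₂ (upTo-countable α) α≮β α≮γ eq)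

    -- Pairing the number of a chosen piece with the number inside that piece would count ω₁.
    not-countable-union : ∀ {a p r} {A : Set a} {P : Pred A p} {R : A → Pred Carrier r} →
      Countable P → (∀ x → Countable (R x)) → ¬ (∀ α → ∃[ x ] (x ∈ P × α ∈ R x))
    not-countable-union {P = P} {R} (f , f-injective) R-countable cover = uncountable
      ( (λ α → index α (cover α))
      , λ {α} {β} _ _ eq → index-injective (cover α) (cover β) (pair-injective _ _ _ _ eq))
      where
      index : ∀ α → ∃[ x ] (x ∈ P × α ∈ R x) → ℕ
      index α (x , _) = pair (f x) (proj₁ (R-countable x) α)

      index-injective : ∀ {α β} (w : ∃[ x ] (x ∈ P × α ∈ R x)) (v : ∃[ x ] (x ∈ P × β ∈ R x)) →
        f (proj₁ w) ≡ f (proj₁ v) ×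
        proj₁ (R-countable (proj₁ w)) α ≡ proj₁ (R-countable (proj₁ v)) β → α ≡ β
      index-injective (x , x∈P , α∈Rx) (y , y∈P , β∈Ry) (eq₁ , eq₂)
        with refl ← f-injective x∈P y∈P eq₁ = proj₂ (R-countable x) α∈Rx β∈Ry eq₂

    -- Otherwise every `β` is at most some `F n γ` with `γ` up to `α`, and countably many countable
    -- initial segments cover ω₁.
    bounded : (F : ℕ → Carrier → Carrier) (α : Carrier) →
              ∃[ β ] (∀ n γ → ¬ (α < γ) → F n γ < β)
    bounded F α = byContradiction λ unbounded →
      not-countable-union (upTo×ℕ-countable α) (λ (γ , n) → upTo-countable (F n γ)) λ β →
        byContradiction λ small → unbounded
          (β , λ n γ α≮γ → byContradiction λ ≮β → small ((γ , n) , α≮γ , ≮β))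

    supremum : (s : ℕ → Carrier) →
               ∃[ δ ] ((∀ n → s n < δ) × (∀ γ → γ < δ → ∃[ n ] ¬ (s n < γ)))
    supremum s
      with α , s<α ← bounded (λ n _ → s n) (s 0)
      with δ , s<δ , minimal ← least (λ δ → ∀ n → s n < δ) (α , λ n → s<α n (s 0) <-irrefl)
      = δ , s<δ , λ γ γ<δ → byContradiction λ ∄n →
          minimal γ γ<δ λ n → byContradiction λ s≮γ → ∄n (n , s≮γ)

    -- The first component excludes 0, which is vacuously closed but is not a limit.
    ClosedUnder : (ℕ → Carrier → Carrier) → Pred Carrier ℓ
    ClosedUnder F δ = (∃[ β ] β < δ) × (∀ n β → β < δ → F n β < δ)

    -- For unboundedness, iterate `bounded` from `β`: each `γ` below the supremum is at most some
    -- iterate, and the next iterate exceeds every `F n γ`.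
    closedUnder-club : ∀ F → Club Ω (ClosedUnder F)
    closedUnder-club F = record { unbounded = unbounded ; closed = closed }
      where
      unbounded : ∀ β → ∃[ δ ] (ClosedUnder F δ × β < δ)
      unbounded β with supremum iterate
        where
        iterate : ℕ → Carrier
        iterate zero    = β
        iterate (ℕ.suc k) = proj₁ (bounded F (iterate k))
      ... | δ , s<δ , cofinal = δ , ((β , s<δ 0) , closure) , s<δ 0
        where
        closure : ∀ n γ → γ < δ → F n γ < δ
        closure n γ γ<δ with k , s≮γ ← cofinal γ γ<δ =
          <-trans (proj₂ (bounded F _) n γ s≮γ) (s<δ (ℕ.suc k))

      closed : ∀ δ → IsLimit Ω δ →
        (∀ β → β < δ → ∃[ γ ] (ClosedUnder F γ × β < γ × γ < δ)) → ClosedUnder F δ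
      closed δ (nonzero , _) cofinal = nonzero , λ n β β<δ →
        let γ , (_ , closure) , β<γ , γ<δ = cofinal β β<δ
        in <-trans (closure n β β<γ) γ<δ

    clubAbove : ∀ {C} → Club Ω C → ∀ α β → ∃[ γ ] (γ ∈ C × α < γ × β < γ)
    clubAbove club α β with compare α β
    ... | tri< α<β _ _ = let γ , γ∈C , β<γ = Club.unbounded club β in
                         γ , γ∈C , <-trans α<β β<γ , β<γ
    ... | tri≈ _ refl _ = let γ , γ∈C , β<γ = Club.unbounded club β in γ , γ∈C , β<γ , β<γ
    ... | tri> _ _ β<α = let γ , γ∈C , α<γ = Club.unbounded club α in
                         γ , γ∈C , α<γ , <-trans β<α α<γ

    -- Ranks with values in ω₁.

    module Ranking {A : Set ℓ} (_≺_ : Rel A ℓ) where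

      -- A relation rather than a function, since `a` has no rank when the ranks of its predecessors
      -- exhaust ω₁.
      data Rank (a : A) (α : Carrier) : Set ℓ where
        rank : (∀ b → b ≺ a → ∃[ β ] (β < α × Rank b β)) →
               (∀ β → β < α → ∃[ b ] (b ≺ a × Rank b β)) → Rank a α

      rank-unique : ∀ {a α β} → Rank a α → Rank a β → α ≡ β
      rank-unique {a} {α} {β} (rank lower₁ upper₁) (rank lower₂ upper₂) with compare α β
      ... | tri≈ _ α≡β _ = α≡β
      ... | tri< α<β _ _
          with b , b≺a , Rbα ← upper₂ α α<β
          with γ , γ<α , Rbγ ← lower₁ b b≺a
          with refl ← rank-unique Rbγ Rbα = contradiction γ<α <-irrefl
      ... | tri> _ _ β<α
          with b , b≺a , Rbβ ← upper₁ β β<α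
          with γ , γ<β , Rbγ ← lower₂ b b≺a
          with refl ← rank-unique Rbβ Rbγ = contradiction γ<β <-irrefl

      rank-mono : ∀ {a b α β} → a ≺ b → Rank a α → Rank b β → α < β
      rank-mono {a} {β = β} a≺b R (rank lower₁ _) with γ , γ<β , R′ ← lower₁ a a≺b =
        subst (_< β) (rank-unique R′ R) γ<β

      module Height
               (≺-trans : ∀ {a b c} → a ≺ b → b ≺ c → a ≺ c)
               (≺-wellFounded : WellFounded _≺_)
               (short : ∀ a → (∀ b → b ≺ a → ∃ (Rank b)) →
                        ¬ (∀ α → ∃[ b ] (b ≺ a × Rank b α))) where

        abstract
          -- The rank is the least ordinal `α` that no predecessor has as its rank; `short` provides
          -- one. A predecessor of larger rank would have a predecessor of rank `α`, which by
          -- transitivity is also below `a`.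
          rankOf : ∀ a → ∃ (Rank a)
          rankOf a = go a (≺-wellFounded a)
            where
            go : ∀ a → Acc _≺_ a → ∃ (Rank a)
            go a (acc rs)
              with α , α∉ , minimal ← least (λ α → ¬ (∃[ b ] (b ≺ a × Rank b α)))
                     (byContradiction λ all → short a (λ b b≺a → go b (rs b≺a))
                       λ α → byContradiction λ α∉ → all (α , α∉))
              = α , rank lower′ λ β β<α → byContradiction (minimal β β<α)
              where
              lower′ : ∀ b → b ≺ a → ∃[ β ] (β < α × Rank b β)
              lower′ b b≺a with β , Rbβ@(rank _ upper) ← go b (rs b≺a) with compare β α
              ... | tri< β<α _ _ = β , β<α , Rbβ
              ... | tri≈ _ refl _ = contradiction (b , b≺a , Rbβ) α∉
              ... | tri> _ _ α<β = let b′ , b′≺b , Rb′α = upper α α<β in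
                                   contradiction (b′ , ≺-trans b′≺b b≺a , Rb′α) α∉

        height : A → Carrier
        height = proj₁ ∘ rankOf

        height-mono : ∀ {a b} → a ≺ b → height a < height b
        height-mono {a} {b} a≺b = rank-mono a≺b (proj₂ (rankOf a)) (proj₂ (rankOf b))

        below-height : ∀ {a α} → α < height a → ∃[ b ] (b ≺ a × height b ≡ α)
        below-height {a} {α} α<h with β , rank _ upper₁ ← rankOf a
          with b , b≺a , Rbα ← upper₁ α α<h
          = b , b≺a , rank-unique (proj₂ (rankOf b)) Rbα

    -- An injection ω₁ × ω → ω₁: the rank function of the lexicographic order.
    private
      _≺_ : Rel (Carrier × ℕ) ℓ
      _≺_ = ×-Lex _≡_ _<_ ℕ._<_

      ≺-trans : ∀ {x y z} → x ≺ y → y ≺ z → x ≺ z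
      ≺-trans (inj₁ p)          (inj₁ q)          = inj₁ (<-trans p q)
      ≺-trans (inj₁ p)          (inj₂ (refl , _)) = inj₁ p
      ≺-trans (inj₂ (refl , _)) (inj₁ q)          = inj₁ q
      ≺-trans (inj₂ (refl , p)) (inj₂ (refl , q)) = inj₂ (refl , ℕ.<-trans p q)

      ≺⇒≯ : ∀ {x y} → x ≺ y → ¬ (proj₁ y < proj₁ x)
      ≺⇒≯ (inj₁ p)          q = <-irrefl (<-trans p q)
      ≺⇒≯ (inj₂ (refl , _)) q = <-irrefl q

      open Ranking _≺_ using (Rank; rank-unique)

      -- Points below `x` have first component at most that of `x`, so they are countably many, each
      -- with at most one rank.
      ≺-short : ∀ x → ¬ (∀ α → ∃[ y ] (y ≺ x × Rank y α))
      ≺-short (β , _) onto = not-countable-union {R = Rank} (upTo×ℕ-countable β)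
        (λ _ → (λ _ → 0) , λ R R′ _ → rank-unique R R′)
        λ α → let y , y≺x , R = onto α in y , ≺⇒≯ y≺x , R

      ≺-wellFounded : WellFounded _≺_
      ≺-wellFounded = ×-wellFounded <-wellFounded ℕ-<-wellFounded

      open Ranking.Height _≺_ ≺-trans ≺-wellFounded (λ x _ → ≺-short x)
        using (height; height-mono)

    code : Carrier × ℕ → Carrier
    code = height

    code-injective : ∀ x y → code x ≡ code y → x ≡ y
    code-injective x@(α , m) y@(β , n) eq = go (compare α β) (ℕ.<-cmp m n)
      where
      go : _ → _ → x ≡ y
      go (tri< α<β _ _)  _               = contradiction eq (<⇒≢ (height-mono (inj₁ α<β)))
      go (tri> _ _ β<α)  _               = contradiction (sym eq) (<⇒≢ (height-mono (inj₁ β<α)))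
      go (tri≈ _ refl _) (tri< m<n _ _)  = contradiction eq (<⇒≢ (height-mono (inj₂ (refl , m<n))))
      go (tri≈ _ refl _) (tri> _ _ n<m)  = contradiction (sym eq) (<⇒≢ (height-mono (inj₂ (refl , n<m))))
      go (tri≈ _ refl _) (tri≈ _ refl _) = refl

  -- Heights and levels of the tree.

  module Diamond (Ω : Omega₁ ℓ) (T : Tree ℓ) (ω₁-tree : IsOmega₁Tree T Ω) where
    private module Ω = Ordinals Ω
    open Tree T
    open IsOmega₁Tree ω₁-tree
    open Ω.Ranking _<_ using (Rank; rank-mono; rank-unique)
    private module SPO = IsStrictPartialOrder isStrictPartialOrder

    <-wellFounded : WellFounded _<_
    <-wellFounded t = acc λ {s} s<t → go (WellOrdered.wellFounded (↓-wellOrdered t) (s , s<t))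
      where
      go : ∀ {x : ∃ (t ↓)} → Acc (_<_ on proj₁) x → Acc _<_ (proj₁ x)
      go {_ , s<t} (acc rs) = acc λ {r} r<s → go (rs {r , SPO.trans r<s s<t} r<s)

    -- Only predecessors of `t` need ranks, so this can already serve to show that heights exist,
    -- with `Q` all of ω₁; later `Q` is the set of ordinals below `ht t`.
    ↓-sameOrderType : ∀ {q t} {Q : Pred Ω.Carrier q} (r : ∀ s → s < t → ∃ (Rank s)) →
      (∀ s (s<t : s < t) → proj₁ (r s s<t) ∈ Q) →
      (∀ α → α ∈ Q → ∃[ s ] (s < t × Rank s α)) →
      SameOrderType _<_ (t ↓) Ω._<_ Q
    ↓-sameOrderType {t = t} {Q} r r∈Q onto = f , record
      { isOrderMonomorphism = record
        { isOrderHomomorphism = record { cong = f-cong ; mono = f-mono }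
        ; injective = f-injective
        ; cancel    = f-cancel
        }
      ; surjective = λ (α , α∈Q) → let s , s<t , R = onto α α∈Q in
          (s , s<t) , λ { {_ , s<t′} refl → rank-unique (proj₂ (r s s<t′)) R }
      }
      where
      f : ∃ (t ↓) → ∃ Q
      f (s , s<t) = proj₁ (r s s<t) , r∈Q s s<t

      ↓-compare : Trichotomous {A = ∃ (t ↓)} (_≡_ on proj₁) (_<_ on proj₁)
      ↓-compare = IsStrictTotalOrder.compare (WellOrdered.isStrictTotalOrder (↓-wellOrdered t))

      f-cong : ∀ {x y : ∃ (t ↓)} → proj₁ x ≡ proj₁ y → proj₁ (f x) ≡ proj₁ (f y)
      f-cong {_ , s<t} {_ , s<t′} refl = rank-unique (proj₂ (r _ s<t)) (proj₂ (r _ s<t′))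

      f-mono : ∀ {x y : ∃ (t ↓)} → proj₁ x < proj₁ y → proj₁ (f x) Ω.< proj₁ (f y)
      f-mono {_ , x<t} {_ , y<t} x<y = rank-mono x<y (proj₂ (r _ x<t)) (proj₂ (r _ y<t))

      f-injective : ∀ {x y : ∃ (t ↓)} → proj₁ (f x) ≡ proj₁ (f y) → proj₁ x ≡ proj₁ y
      f-injective {x} {y} eq with ↓-compare x y
      ... | tri< x<y _ _ = contradiction eq (Ω.<⇒≢ (f-mono {x} {y} x<y))
      ... | tri≈ _ x≡y _ = x≡y
      ... | tri> _ _ y<x = contradiction (sym eq) (Ω.<⇒≢ (f-mono {y} {x} y<x))

      f-cancel : ∀ {x y : ∃ (t ↓)} → proj₁ (f x) Ω.< proj₁ (f y) → proj₁ x < proj₁ y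
      f-cancel {x} {y} fx<fy with ↓-compare x y
      ... | tri< x<y _ _ = x<y
      ... | tri≈ _ x≡y _ = contradiction (f-cong {x} {y} x≡y) (Ω.<⇒≢ fx<fy)
      ... | tri> _ _ y<x = contradiction (Ω.<-trans (f-mono {y} {x} y<x) fx<fy) Ω.<-irrefl

    -- If the ranks below `t` exhausted ω₁, then `t` would lie on level ω₁, which is empty.
    open Ω.Ranking.Height _<_ SPO.trans <-wellFounded
      (λ t r onto → levelω₁-empty
        (t , ↓-sameOrderType r (λ _ _ → _) λ α _ → onto α))
      renaming (height to ht; height-mono to ht-mono; below-height to below-ht)

    ht∈level : ∀ t → t ∈ Level[_] T Ω (ht t)
    ht∈level t = ↓-sameOrderType (λ s _ → rankOf s) (λ s → ht-mono) λ α α<ht →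
      let s , s<t , eq = below-ht α<ht in s , s<t , subst (Rank s) eq (proj₂ (rankOf s))

    index : Carrier → ℕ
    index t = proj₁ (level-countable (ht t)) t

    index-injective : ∀ {s t} → ht s ≡ ht t → index s ≡ index t → s ≡ t
    index-injective {s} {t} hs≡ht is≡it = proj₂ (level-countable (ht t))
      (subst (λ α → s ∈ Level[_] T Ω α) hs≡ht (ht∈level s)) (ht∈level t)
      (trans (cong (λ α → proj₁ (level-countable α) s) (sym hs≡ht)) is≡it)

    -- Nodes whose heights avoid a club.

    avoiding-club∈NS : ∀ {E : Pred Ω.Carrier ℓ} {B : Pred Carrier ℓ} →
      Club Ω E → (∀ t → t ∈ B → ht t ∉ E) → NS T B
    avoiding-club∈NS {E} {B} club avoids = f , regressive , special
      where
      open Club club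

      Gap : Carrier → Pred Carrier ℓ
      Gap t s = s < t × (∀ γ → γ ∈ E → ht s Ω.< γ → ¬ (γ Ω.< ht t))

      root≮ : ∀ {t} → ¬ (t < root)
      root≮ {t} t<root with root-least t
      ... | inj₁ refl   = SPO.irrefl refl t<root
      ... | inj₂ root<t = SPO.asym t<root root<t

      -- Without a gap, `E` is cofinal in `ht t`; then `ht t` is a limit and lies in `E` by
      -- closedness.
      gap : ∀ t → t ∈ B → root < t → ∃ (Gap t)
      gap t t∈B root<t = byContradiction λ ∄gap →
        let
          cofinal : ∀ β → β Ω.< ht t → ∃[ γ ] (γ ∈ E × β Ω.< γ × γ Ω.< ht t)
          cofinal β β<ht = byContradiction λ ∄γ →
            let s , s<t , eq = below-ht β<ht in
            ∄gap (s , s<t , λ γ γ∈E hs<γ γ<ht →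
              ∄γ (γ , γ∈E , subst (Ω._< γ) eq hs<γ , γ<ht))
        in avoids t t∈B (closed (ht t)
             ( (ht root , ht-mono root<t)
             , λ β β<ht → let γ , _ , β<γ , γ<ht = cofinal β β<ht in γ , β<γ , γ<ht)
             cofinal)

      choose : ∀ {t} → Dec (∃ (Gap t)) → Carrier
      choose (yes (s , _)) = s
      -- On `B` this default is reached only at the root.
      choose (no _)        = root

      f : Carrier → Carrier
      f t = choose (em₀ {∃ (Gap t)})

      regressive : Regressive T B f
      regressive t t∈B t≢root with em₀ {∃ (Gap t)} | root-least t
      ... | yes (_ , s<t , _) | _           = s<t
      ... | no _              | inj₁ t≡root = contradiction t≡root t≢root
      ... | no ∄gap           | inj₂ root<t = contradiction (gap t t∈B root<t) ∄gap

      fibre-bounded : ∀ {s t γ} → γ ∈ E → ht s Ω.< γ → t ∈ B → f t ≡ s → ¬ (γ Ω.< ht t)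
      fibre-bounded {t = t} {γ} γ∈E hs<γ t∈B ft≡s γ<ht with em₀ {∃ (Gap t)} | root-least t | ft≡s
      ... | yes (_ , _ , empty) | _           | refl = empty γ γ∈E hs<γ γ<ht
      ... | no ∄gap             | inj₂ root<t | _    = ∄gap (gap t t∈B root<t)
      ... | no _                | inj₁ refl   | _    = root≮ (proj₁ (proj₂ (below-ht γ<ht)))

      special : ∀ s → Special T (B ∩ λ t → f t ≡ s)
      special s with γ , γ∈E , hs<γ ← unbounded (ht s) = A , antichain ,
        (λ {t} t∈ → proj₁ (Ω.upTo-countable γ) (ht t) , t∈ , refl) , λ (_ , t∈ , _) → t∈
        where
        A : ℕ → Pred Carrier ℓ
        -- Heights up to `γ` are numbered injectively, so each `A n` lies within a single level.
        A n t = (t ∈ B × f t ≡ s) × proj₁ (Ω.upTo-countable γ) (ht t) ≡ n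

        antichain : ∀ n → Antichain T (A n)
        antichain n {t} {u} ((t∈B , ft≡s) , eq) ((u∈B , fu≡s) , eq′) t<u =
          Ω.<⇒≢ (ht-mono t<u) (proj₂ (Ω.upTo-countable γ)
            (fibre-bounded γ∈E hs<γ t∈B ft≡s) (fibre-bounded γ∈E hs<γ u∈B fu≡s)
            (trans eq (sym eq′)))

    -- Extracting a diamond sequence on ω₁.

    ◇ₜ⇒◇ : ◇ₜ T → ◇ Ω
    ◇ₜ⇒◇ (D , _ , D-guesses) = decide em
      where
      -- A level may have no node of index `n`; the existential then makes the guess empty.
      G : ℕ → Ω.Carrier → Pred Ω.Carrier ℓ
      G n α β = β Ω.< α × ∃[ t ] (ht t ≡ α × index t ≡ n ×
                                  ∃[ s ] (s ∈ D t × ht s ≡ Ω.code (β , n)))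

      Guesses : ℕ → Set (suc ℓ)
      Guesses n = ∀ X → Stationary Ω (λ α → (X ∩ Ω.below α) ≐ G n α)

      Refuted : ℕ → Set (suc ℓ)
      Refuted n = Σ[ Y ∈ Pred Ω.Carrier ℓ ] Σ[ C ∈ Pred Ω.Carrier ℓ ]
        Club Ω C × (∀ α → α ∈ C → ¬ ((Y ∩ Ω.below α) ≐ G n α))

      -- Excluded middle applied to `Refuted n` itself selects the set and the club, so that they
      -- become functions of `n`.
      refute : ∀ {n} → ¬ Guesses n → Refuted n
      refute ¬guesses = decidable-stable em λ ¬refuted → ¬guesses
        (λ Y C club → byContradiction λ ∄α →
          ¬refuted (Y , C , club , λ α α∈C eq → ∄α (α , eq , α∈C)))

      not-all-refuted : ¬ (∀ n → Refuted n)
      not-all-refuted refuted = D-guesses X (avoiding-club∈NS E-club avoids)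
        where
        Y : ℕ → Pred Ω.Carrier ℓ
        Y n = proj₁ (refuted n)

        C-club : ∀ n → Club Ω (proj₁ (proj₂ (refuted n)))
        C-club n = proj₁ (proj₂ (proj₂ (refuted n)))

        -- Closure under `next n` does double duty: it makes an ordinal a limit of points of the
        -- n-th club and closes it under `code (_ , n)`.
        next : ∀ n β → _
        next n β = Ω.clubAbove (C-club n) β (Ω.code (β , n))

        E : Pred Ω.Carrier ℓ
        E = Ω.ClosedUnder λ n β → proj₁ (next n β)

        E-club : Club Ω E
        E-club = Ω.closedUnder-club _

        E⊆C : ∀ n {α} → α ∈ E → α ∈ proj₁ (proj₂ (refuted n))
        E⊆C n {α} ((β₀ , β₀<α) , closure) = Club.closed (C-club n) α
          ((β₀ , β₀<α) , λ β β<α → let γ , _ , β<γ , γ<α = cofinal β β<α in γ , β<γ , γ<α) cofinal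
          where
          cofinal : ∀ β → β Ω.< α → _
          cofinal β β<α = let γ , γ∈C , β<γ , _ = next n β in γ , γ∈C , β<γ , closure n β β<α

        X : Pred Carrier ℓ
        X t = ∃[ n ] ∃[ β ] (β ∈ Y n × ht t ≡ Ω.code (β , n))

        avoids : ∀ t → (X ∩ t ↓) ≐ D t → ht t ∉ E
        avoids t (X⊆D , D⊆X) ht∈E@(_ , closure) =
          proj₂ (proj₂ (proj₂ (refuted n))) (ht t) (E⊆C n ht∈E) (Y⊆G , G⊆Y)
          where
          n : ℕ
          n = index t

          Y⊆G : ∀ {β} → β ∈ Y n × β Ω.< ht t → β ∈ G n (ht t)
          Y⊆G {β} (β∈Y , β<ht) =
            let _ , _ , _ , code<next = next n β
                -- The code lies below `ht t`, so `t` has a predecessor at that height, and this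
                -- node belongs to `X`.
                s , s<t , eq = below-ht (Ω.<-trans code<next (closure n β β<ht))
            in β<ht , t , refl , refl , s , X⊆D ((n , β , β∈Y , eq) , s<t) , eq

          G⊆Y : ∀ {β} → β ∈ G n (ht t) → β ∈ Y n × β Ω.< ht t
          G⊆Y {β} (β<ht , t′ , ht≡ , index≡ , s , s∈D , eq)
            -- Level and index determine the node, so the guess was read off at `t`.
            with refl ← index-injective {t′} {t} ht≡ index≡
            with (m , β′ , β′∈Y , eq′) , _ ← D⊆X s∈D
            -- Distinct entries have disjoint codes, so the node `s` testifies about the n-th set
            -- only.
            with refl ← Ω.code-injective (β , n) (β′ , m) (trans (sym eq) eq′)
            = β′∈Y , β<ht

      decide : Dec (∃ Guesses) → ◇ Ω
      decide (yes (n , guesses)) = G n , (λ _ → proj₁) , guesses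
      decide (no ∄n) = contradiction (λ n → refute (λ guesses → ∄n (n , guesses))) not-all-refuted

corollary3p5 : ∀ {ℓ : Level} → ExcludedMiddle (suc ℓ) →
    (Ω : Omega₁ ℓ) (T : Tree ℓ) →
    IsOmega₁Tree T Ω → NonspecialTree T →
    ◇ₜ T → ◇ Ω
corollary3p5 em Ω T ω₁-tree _ = Diamond.◇ₜ⇒◇ em Ω T ω₁-tree
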